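{- Let $F$ be a one-dimensional tropical fan in $\mathbb{R}^n$ whose rays span $\mathbb{R}^n$. Let $P=\{\mathbb{R}_+v_0,\dots,\mathbb{R}_+v_k\}$ be a gallery class of $F$ with $k+1\ge2$ distinct rays, with primitive generators $v_0,\dots,v_k$. Fix $i\in\{0,\dots,k\}$ and, for $j\in\{0,\dots,k\}\setminus\{i\}$, let $l_{ij}\in(\mathbb{Z}^n)^\vee$ be the unique functional with $g_{l_{ij}}(v_i,v_j)\in\mathrm{Gly}(F)$. Then the $k$ linear functionals $l_{ij}$ ($j\ne i$) are linearly independent. Moreover, if $\pi:\mathbb{Z}^n\to\mathbb{Z}^k$ is the homomorphism given by the integer matrix whose rows are the $l_{ij}$ ($j\neq i$), then $|\mathbb{Z}^k/\pi(\mathbb{Z}^n)|=1$.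
   Context: A one-dimensional tropical fan $F$ in $\mathbb{R}^n$ consists of finitely many distinct rays $\mathbb{R}_+v$ (and the origin), each with primitive generator $v\in\mathbb{Z}^n$ and a positive integer weight $\omega_v$, satisfying the balancing condition $\sum_v\omega_vv=0$. For $l\in(\mathbb{Z}^n)^\vee$ put $\max(0,l)\cdot F=\sum_v\omega_v\max(0,l(v))$. If this equals $1$, the gallery of $F$ over $\max(0,l)$ is the set of rays $\mathbb{R}_+v$ of $F$ with $|l(v)|=1$. $\mathrm{Gly}(F)$ is the set of all galleries of $F$. The notation $g_l(v_a,v_b)\in\mathrm{Gly}(F)$ means that $\max(0,l)\cdot F=1$, that the gallery over $\max(0,l)$ is $\{\mathbb{R}_+v_a,\mathbb{R}_+v_b\}$, and that $l(v_a)=1$, $l(v_b)=-1$; equivalently, $l(v_a)=1$, $l(v_b)=-1$, both rays have weight $1$, and $l(v)=0$ for all other primitive generators $v$ of $F$. Such an $l$ is unique given $(v_a,v_b)$. The relation on rays "equal, or together forming a gallery of $F$" is an equivalence relation; its equivalence classes are called gallery classes here. -}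

module Defs where

open import Data.Fin.Base using (Fin; zero; suc)
open import Data.Integer.Base as ℤ using (ℤ; +_; 0ℤ; 1ℤ; -1ℤ)
import Data.Integer.Properties as ℤ
open import Data.Nat.Base as ℕ using (ℕ)
open import Data.Nat.Divisibility using (_∣_)
import Data.Nat.Properties as ℕ
open import Data.Product.Base using (∃; _×_; _,_)
open import Data.Rational.Base as ℚ using (ℚ; 0ℚ; 1ℚ; ½)
import Data.Rational.Properties as ℚ
open import Data.Sum.Base using (_⊎_)
open import Data.Vec.Functional using (Vector; foldr)
open import Function.Bundles using (Bijection)
open import Function.Definitions using (Injective)
open import Level using (0ℓ)
open import Relation.Binary.Bundles using (Setoid)
open import Relation.Binary.PropositionalEquality
open import Relation.Unary using (Pred; _∈_; _≐_; ｛_｝; _∪_)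

open import Algebra.Properties.Semiring.Sum ℤ.+-*-semiring as ℤΣ using (sum-syntax)
import Data.Integer.Solver
open import Data.Rational.Solver using (module +-*-Solver)

private
  module ℤ-Solver = Data.Integer.Solver.+-*-Solver

-- Real numbers are Cauchy sequences of rationals, with equality "the
-- difference tends to 0".  Linear combinations below always have real
-- coefficients and integer vectors, so addition and multiplication by
-- integers are the only operations needed.

infix 4 _≃_

record ℝ : Set where
  constructor mkℝ
  field
    seq    : ℕ → ℚ
    cauchy : ∀ ε → 0ℚ ℚ.< ε → ∃ λ N → ∀ m n → N ℕ.≤ m → N ℕ.≤ n →
             ℚ.∣ seq m ℚ.- seq n ∣ ℚ.< ε

open ℝ public

_≃_ : ℝ → ℝ → Set
x ≃ y = ∀ ε → 0ℚ ℚ.< ε → ∃ λ N → ∀ n → N ℕ.≤ n → ℚ.∣ seq x n ℚ.- seq y n ∣ ℚ.< ε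

0ℝ : ℝ
seq    0ℝ _ = 0ℚ
cauchy 0ℝ ε 0<ε = 0 , λ _ _ _ _ → 0<ε

module _ where
  open +-*-Solver

  private
    half-pos : ∀ ε → 0ℚ ℚ.< ε → 0ℚ ℚ.< ½ ℚ.* ε
    half-pos ε 0<ε = ℚ.*-monoʳ-<-pos ½ 0<ε

    two-halves : ∀ ε → ½ ℚ.* ε ℚ.+ ½ ℚ.* ε ≡ ε
    two-halves ε = trans (sym (ℚ.*-distribʳ-+ ε ½ ½)) (ℚ.*-identityˡ ε)

    regroup : ∀ a b c d → (a ℚ.+ b) ℚ.- (c ℚ.+ d) ≡ (a ℚ.- c) ℚ.+ (b ℚ.- d)
    regroup = solve 4 (λ a b c d → (a :+ b) :- (c :+ d) := (a :- c) :+ (b :- d)) refl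

    factor : ∀ q a b → q ℚ.* a ℚ.- q ℚ.* b ≡ q ℚ.* (a ℚ.- b)
    factor = solve 3 (λ q a b → q :* a :- q :* b := q :* (a :- b)) refl

    bound : ℚ → ℚ
    bound q = 1ℚ ℚ.+ ℚ.∣ q ∣

    bound-pos : ∀ q → ℚ.Positive (bound q)
    bound-pos q = ℚ.pos+nonNeg⇒pos 1ℚ ℚ.∣ q ∣ {{ℚ.∣-∣-nonNeg q}}

    bound-nonZero : ∀ q → ℚ.NonZero (bound q)
    bound-nonZero q = ℚ.pos⇒nonZero (bound q) {{bound-pos q}}

    bound⁻¹ : ℚ → ℚ
    bound⁻¹ q = (ℚ.1/ bound q) {{bound-nonZero q}}

    ≤-bound : ∀ q → ℚ.∣ q ∣ ℚ.≤ bound q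
    ≤-bound q = subst (ℚ._≤ bound q) (ℚ.+-identityˡ ℚ.∣ q ∣)
                      (ℚ.+-monoˡ-≤ ℚ.∣ q ∣ (ℚ.<⇒≤ (ℚ.positive⁻¹ 1ℚ)))

    scaled-pos : ∀ q ε → 0ℚ ℚ.< ε → 0ℚ ℚ.< bound⁻¹ q ℚ.* ε
    scaled-pos q ε 0<ε = subst (ℚ._< bound⁻¹ q ℚ.* ε) (ℚ.*-zeroʳ (bound⁻¹ q))
      (ℚ.*-monoʳ-<-pos (bound⁻¹ q) {{ℚ.1/pos⇒pos (bound q) {{bound-pos q}}}} 0<ε)

  infixl 6 _+ᴿ_
  infixr 7 _·ᴿ_

  _+ᴿ_ : ℝ → ℝ → ℝ
  seq    (x +ᴿ y) n = seq x n ℚ.+ seq y n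
  cauchy (x +ᴿ y) ε 0<ε with cauchy x (½ ℚ.* ε) (half-pos ε 0<ε) | cauchy y (½ ℚ.* ε) (half-pos ε 0<ε)
  ... | N₁ , p₁ | N₂ , p₂ = N₁ ℕ.⊔ N₂ , λ m n N≤m N≤n → begin-strict
    ℚ.∣ (seq x m ℚ.+ seq y m) ℚ.- (seq x n ℚ.+ seq y n) ∣
      ≡⟨ cong ℚ.∣_∣ (regroup (seq x m) (seq y m) (seq x n) (seq y n)) ⟩
    ℚ.∣ (seq x m ℚ.- seq x n) ℚ.+ (seq y m ℚ.- seq y n) ∣
      ≤⟨ ℚ.∣p+q∣≤∣p∣+∣q∣ (seq x m ℚ.- seq x n) (seq y m ℚ.- seq y n) ⟩
    ℚ.∣ seq x m ℚ.- seq x n ∣ ℚ.+ ℚ.∣ seq y m ℚ.- seq y n ∣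
      <⟨ ℚ.+-mono-< (p₁ m n (ℕ.m⊔n≤o⇒m≤o N₁ N₂ N≤m) (ℕ.m⊔n≤o⇒m≤o N₁ N₂ N≤n))
                    (p₂ m n (ℕ.m⊔n≤o⇒n≤o N₁ N₂ N≤m) (ℕ.m⊔n≤o⇒n≤o N₁ N₂ N≤n)) ⟩
    ½ ℚ.* ε ℚ.+ ½ ℚ.* ε
      ≡⟨ two-halves ε ⟩
    ε ∎
    where open ℚ.≤-Reasoning

  _·ᴿ_ : ℤ → ℝ → ℝ
  seq    (z ·ᴿ x) n = (z ℚ./ 1) ℚ.* seq x n
  cauchy (z ·ᴿ x) ε 0<ε with cauchy x (bound⁻¹ (z ℚ./ 1) ℚ.* ε) (scaled-pos (z ℚ./ 1) ε 0<ε)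
  ... | N , p = N , λ m n N≤m N≤n → begin-strict
    ℚ.∣ q ℚ.* seq x m ℚ.- q ℚ.* seq x n ∣
      ≡⟨ cong ℚ.∣_∣ (factor q (seq x m) (seq x n)) ⟩
    ℚ.∣ q ℚ.* (seq x m ℚ.- seq x n) ∣
      ≡⟨ ℚ.∣p*q∣≡∣p∣*∣q∣ q _ ⟩
    ℚ.∣ q ∣ ℚ.* ℚ.∣ seq x m ℚ.- seq x n ∣
      ≤⟨ ℚ.*-monoʳ-≤-nonNeg ℚ.∣ seq x m ℚ.- seq x n ∣ {{ℚ.∣-∣-nonNeg (seq x m ℚ.- seq x n)}} (≤-bound q) ⟩
    B ℚ.* ℚ.∣ seq x m ℚ.- seq x n ∣
      <⟨ ℚ.*-monoʳ-<-pos B {{bound-pos q}} (p m n N≤m N≤n) ⟩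
    B ℚ.* (bound⁻¹ q ℚ.* ε)
      ≡⟨ sym (ℚ.*-assoc B (bound⁻¹ q) ε) ⟩
    (B ℚ.* bound⁻¹ q) ℚ.* ε
      ≡⟨ cong (ℚ._* ε) (ℚ.*-inverseʳ B {{bound-nonZero q}}) ⟩
    1ℚ ℚ.* ε
      ≡⟨ ℚ.*-identityˡ ε ⟩
    ε ∎
    where
    open ℚ.≤-Reasoning
    q = z ℚ./ 1
    B = bound q

sumᴿ : ∀ {m} → Vector ℝ m → ℝ
sumᴿ = foldr _+ᴿ_ 0ℝ

linComb : ∀ {m n} → Vector ℝ m → Vector (Vector ℤ n) m → Vector ℝ n
linComb c w x = sumᴿ λ a → w a x ·ᴿ c a

SpansReal : ∀ {m n} → Vector (Vector ℤ n) m → Set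
SpansReal {m} {n} w = (y : Vector ℝ n) → ∃ λ (c : Vector ℝ m) → ∀ x → linComb c w x ≃ y x

LinearlyIndependent : ∀ {m n} → Vector (Vector ℤ n) m → Set
LinearlyIndependent {m} w =
  (c : Vector ℝ m) → (∀ x → linComb c w x ≃ 0ℝ) → ∀ a → c a ≃ 0ℝ

-- Elements of the dual lattice are given by their coordinates in the dual
-- basis, i.e. as integer row vectors.

Dual : ℕ → Set
Dual n = Vector ℤ n

infix 9 _⟨_⟩

_⟨_⟩ : ∀ {n} → Dual n → Vector ℤ n → ℤ
_⟨_⟩ {n} l v = ∑[ x < n ] (l x ℤ.* v x)

-- The gcd of the coordinates is 1; in particular the zero vector is excluded.
Primitive : ∀ {n} → Vector ℤ n → Set
Primitive v = ∀ d → (∀ x → d ∣ ℤ.∣ v x ∣) → d ≡ 1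

-- A rational ray is determined by its primitive generator, so rays are
-- represented by indices, distinct indices having distinct generators.
record Fan (n : ℕ) : Set where
  field
    size        : ℕ

  Ray : Set
  Ray = Fin size

  field
    gen         : Ray → Vector ℤ n
    weight      : Ray → ℕ
    isPrimitive : ∀ a → Primitive (gen a)
    distinct    : Injective _≡_ _≗_ gen
    positive    : ∀ a → 0 ℕ.< weight a
    balanced    : ∀ x → ∑[ a < size ] (+ weight a ℤ.* gen a x) ≡ 0ℤ

module _ {n : ℕ} (F : Fan n) where
  open Fan F

  -- The intersection number max(0,l)·F.
  degree : Dual n → ℤ
  degree l = ∑[ a < size ] (+ weight a ℤ.* (0ℤ ℤ.⊔ l ⟨ gen a ⟩))

  galleryOver : Dual n → Pred Ray 0ℓ
  galleryOver l a = ℤ.∣ l ⟨ gen a ⟩ ∣ ≡ 1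

  Gly : Pred (Pred Ray 0ℓ) 0ℓ
  Gly S = ∃ λ (l : Dual n) → degree l ≡ 1ℤ × S ≐ galleryOver l

  -- g_l(v_a , v_b) ∈ Gly(F)
  IsGallery : Dual n → Ray → Ray → Set
  IsGallery l a b =
    degree l ≡ 1ℤ × galleryOver l ≐ ｛ a ｝ ∪ ｛ b ｝ ×
    l ⟨ gen a ⟩ ≡ 1ℤ × l ⟨ gen b ⟩ ≡ -1ℤ

  GalleryRelated : Ray → Ray → Set
  GalleryRelated a b = a ≡ b ⊎ (｛ a ｝ ∪ ｛ b ｝) ∈ Gly

  IsGalleryClass : Pred Ray 0ℓ → Set
  IsGalleryClass P = ∃ λ a → P ≐ GalleryRelated a

  RaysSpan : Set
  RaysSpan = SpansReal gen

image : ∀ {A B : Set} → (A → B) → Pred B 0ℓ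
image f b = ∃ λ a → f a ≡ b

matrixMap : ∀ {k n} → Vector (Dual n) k → Vector ℤ n → Vector ℤ k
matrixMap M v j = M j ⟨ v ⟩

private
  pair-0 : ∀ {n} (l : Dual n) → l ⟨ (λ _ → 0ℤ) ⟩ ≡ 0ℤ
  pair-0 {ℕ.zero}  l = refl
  pair-0 {ℕ.suc n} l = cong₂ ℤ._+_ (ℤ.*-zeroʳ (l zero)) (pair-0 (λ x → l (suc x)))

  pair-neg : ∀ {n} (l : Dual n) v → l ⟨ (λ x → ℤ.- v x) ⟩ ≡ ℤ.- l ⟨ v ⟩
  pair-neg {ℕ.zero}  l v = refl
  pair-neg {ℕ.suc n} l v =
    trans (cong₂ ℤ._+_ (sym (ℤ.neg-distribʳ-* (l zero) (v zero)))
                       (pair-neg (λ x → l (suc x)) (λ x → v (suc x))))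
          (sym (ℤ.neg-distrib-+ (l zero ℤ.* v zero) _))

  pair-+ : ∀ {n} (l : Dual n) v w → l ⟨ (λ x → v x ℤ.+ w x) ⟩ ≡ l ⟨ v ⟩ ℤ.+ l ⟨ w ⟩
  pair-+ {n} l v w =
    trans (ℤΣ.sum-cong-≗ (λ x → ℤ.*-distribˡ-+ (l x) (v x) (w x)))
          (ℤΣ.∑-distrib-+ (λ x → l x ℤ.* v x) (λ x → l x ℤ.* w x))

  flip-diff : ∀ a b → ℤ.- (a ℤ.- b) ≡ b ℤ.- a
  flip-diff = solve 2 (λ a b → :- (a :- b) := b :- a) refl
    where open ℤ-Solver

  telescope : ∀ a b c → (a ℤ.- b) ℤ.+ (b ℤ.- c) ≡ a ℤ.- c
  telescope = solve 3 (λ a b c → (a :- b) :+ (b :- c) := a :- c) refl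
    where open ℤ-Solver

-- ℤᵏ / π(ℤⁿ), for π the homomorphism given by the matrix M.
Cokernel : ∀ {k n} → Vector (Dual n) k → Setoid 0ℓ 0ℓ
Cokernel {k} {n} M = record
  { Carrier = Vector ℤ k
  ; _≈_     = λ y z → ∃ λ (v : Vector ℤ n) → ∀ j → y j ℤ.- z j ≡ matrixMap M v j
  ; isEquivalence = record
    { refl  = λ {y} → (λ _ → 0ℤ) , λ j → trans (ℤ.+-inverseʳ (y j)) (sym (pair-0 (M j)))
    ; sym   = λ {y} {z} (v , e) → (λ x → ℤ.- v x) , λ j →
        trans (sym (flip-diff (y j) (z j))) (trans (cong ℤ.-_ (e j)) (sym (pair-neg (M j) v)))
    ; trans = λ {x} {y} {z} (v , e) (w , f) → (λ t → v t ℤ.+ w t) , λ j →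
        trans (sym (telescope (x j) (y j) (z j)))
              (trans (cong₂ ℤ._+_ (e j) (f j)) (sym (pair-+ (M j) v w)))
    }
  }

HasCardinality : Setoid 0ℓ 0ℓ → ℕ → Set
HasCardinality S m = Bijection S (setoid (Fin m))

{-# OPTIONS --safe #-}

-- By balancing, Σ ω_v max(0,l(v)) = 1 forces Σ ω_v max(0,-l(v)) = 1 as well.  If
-- l(v_a) = 1 and l(v_b) = -1, the rays v_a and v_b already exhaust these two sums, so
-- l vanishes on every other ray.  Hence l_ij(v_m) = -δ_jm for j, m ≠ i: the vectors
-- -v_j form a dual family to the l_ij, which gives independence and surjectivity of π.
module Submission where

open import Defs
open import Data.Fin.Base using (Fin; punchIn)
open import Data.Nat.Base using (ℕ; suc; _≤_)
open import Data.Product.Base using (_×_)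
open import Function.Definitions using (Injective)
open import Relation.Binary.PropositionalEquality using (_≡_)

open import Algebra.Bundles using (CommutativeMonoid; CommutativeRing)
open import Data.Fin.Base using (zero; suc; punchOut)
open import Data.Fin.Properties using (punchInᵢ≢i; punchIn-injective)
open import Data.Integer.Base as ℤ using (ℤ; +_; -[1+_]; 0ℤ; 1ℤ; -1ℤ)
import Data.Integer.Properties as ℤ
import Data.Integer.Solver as ℤ
import Data.Nat.Base as ℕ
import Data.Nat.Properties as ℕ
open import Data.Product.Base using (∃; _,_; proj₁; proj₂)
open import Data.Rational.Base as ℚ using (ℚ; 0ℚ; 1ℚ; ½; toℚᵘ)
import Data.Rational.Properties as ℚ
import Data.Rational.Solver as ℚ
import Data.Rational.Unnormalised.Base as ℚᵘ
import Data.Rational.Unnormalised.Properties as ℚᵘ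
open import Data.Vec.Functional using (Vector; removeAt)
open import Data.Vec.Functional.Properties using (removeAt-punchOut)
open import Function.Base using (_∘_)
open import Relation.Binary.PropositionalEquality
  using (_≢_; refl; sym; trans; cong; cong₂; subst; module ≡-Reasoning)

import Algebra.Properties.CommutativeMonoid.Sum
open import Algebra.Properties.Semiring.Sum ℤ.+-*-semiring as ℤΣ using (sum-syntax)
import Algebra.Properties.Semiring.Sum (CommutativeRing.semiring ℚ.+-*-commutativeRing) as ℚΣ

module _ {a ℓ} (M : CommutativeMonoid a ℓ) where
  open CommutativeMonoid M renaming (refl to ≈-refl; trans to ≈-trans)
  open Algebra.Properties.CommutativeMonoid.Sum M

  sum-single : ∀ {n} (f : Vector Carrier n) i → (∀ j → j ≢ i → f j ≈ ε) → sum f ≈ f i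
  sum-single {suc n} f i off =
    ≈-trans (sum-remove {i = i} f)
      (≈-trans (∙-congˡ (≈-trans (sum-cong-≋ (λ j → off (punchIn i j) (punchInᵢ≢i i j)))
                                 (sum-replicate-zero n)))
               (identityʳ (f i)))

sum-nonNeg : ∀ {n} (f : Vector ℤ n) → (∀ i → 0ℤ ℤ.≤ f i) → 0ℤ ℤ.≤ ℤΣ.sum f
sum-nonNeg {ℕ.zero} f f≥0 = ℤ.≤-refl
sum-nonNeg {suc n}  f f≥0 = ℤ.+-mono-≤ (f≥0 zero) (sum-nonNeg (f ∘ suc) (f≥0 ∘ suc))

term≤sum : ∀ {n} (f : Vector ℤ n) → (∀ i → 0ℤ ℤ.≤ f i) → ∀ i → f i ℤ.≤ ℤΣ.sum f
term≤sum {suc n} f f≥0 i = begin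
  f i                            ≡⟨ ℤ.+-identityʳ (f i) ⟨
  f i ℤ.+ 0ℤ                     ≤⟨ ℤ.+-monoʳ-≤ (f i) (sum-nonNeg (removeAt f i) (f≥0 ∘ punchIn i)) ⟩
  f i ℤ.+ ℤΣ.sum (removeAt f i)  ≡⟨ ℤΣ.sum-remove {i = i} f ⟨
  ℤΣ.sum f                       ∎
  where open ℤ.≤-Reasoning

two-terms≤sum : ∀ {n} (f : Vector ℤ n) → (∀ i → 0ℤ ℤ.≤ f i) →
                ∀ {i j} → i ≢ j → f i ℤ.+ f j ℤ.≤ ℤΣ.sum f
two-terms≤sum {suc n} f f≥0 {i} {j} i≢j = begin
  f i ℤ.+ f j
    ≡⟨ cong (λ z → f i ℤ.+ z) (removeAt-punchOut f i≢j) ⟨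
  f i ℤ.+ removeAt f i (punchOut i≢j)
    ≤⟨ ℤ.+-monoʳ-≤ (f i) (term≤sum (removeAt f i) (f≥0 ∘ punchIn i) (punchOut i≢j)) ⟩
  f i ℤ.+ ℤΣ.sum (removeAt f i)
    ≡⟨ ℤΣ.sum-remove {i = i} f ⟨
  ℤΣ.sum f ∎
  where open ℤ.≤-Reasoning

pairing-∑ : ∀ {m n} (l : Dual n) (z : Vector ℤ m) (v : Vector (Vector ℤ n) m) →
            l ⟨ (λ x → ∑[ a < m ] (z a ℤ.* v a x)) ⟩ ≡ ∑[ a < m ] (z a ℤ.* l ⟨ v a ⟩)
pairing-∑ {m} {n} l z v = begin
  ∑[ x < n ] (l x ℤ.* ∑[ a < m ] (z a ℤ.* v a x))
    ≡⟨ ℤΣ.sum-cong-≗ (λ x → ℤΣ.*-distribˡ-sum (l x) (λ a → z a ℤ.* v a x)) ⟩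
  ∑[ x < n ] ∑[ a < m ] (l x ℤ.* (z a ℤ.* v a x))
    ≡⟨ ℤΣ.∑-comm (λ x a → l x ℤ.* (z a ℤ.* v a x)) ⟩
  ∑[ a < m ] ∑[ x < n ] (l x ℤ.* (z a ℤ.* v a x))
    ≡⟨ ℤΣ.sum-cong-≗ (λ a → ℤΣ.sum-cong-≗ (λ x → swap (l x) (z a) (v a x))) ⟩
  ∑[ a < m ] ∑[ x < n ] (z a ℤ.* (l x ℤ.* v a x))
    ≡⟨ ℤΣ.sum-cong-≗ (λ a → ℤΣ.*-distribˡ-sum (z a) (λ x → l x ℤ.* v a x)) ⟨
  ∑[ a < m ] (z a ℤ.* l ⟨ v a ⟩) ∎
  where
  open ≡-Reasoning
  swap : ∀ p q r → p ℤ.* (q ℤ.* r) ≡ q ℤ.* (p ℤ.* r)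
  swap = solve 3 (λ p q r → p :* (q :* r) := q :* (p :* r)) refl
    where open ℤ.+-*-Solver

positive-part-concentrated :
  ∀ {m} (w : Vector ℕ m) → (∀ a → 0 ℕ.< w a) → (u : Vector ℤ m) →
  ∑[ a < m ] (+ w a ℤ.* (0ℤ ℤ.⊔ u a)) ≡ 1ℤ →
  ∀ {b} → u b ≡ 1ℤ → ∀ {c} → c ≢ b → u c ℤ.≤ 0ℤ
positive-part-concentrated {m} w w>0 u ∑≡1 {b} ub≡1 {c} c≢b = begin
  u c          ≤⟨ ℤ.i≤j⊔i 0ℤ (u c) ⟩
  0ℤ ℤ.⊔ u c   ≤⟨ ℤ.*-cancelˡ-≤-pos (0ℤ ℤ.⊔ u c) 0ℤ (+ w c) {{ℤ.positive (ℤ.+<+ (w>0 c))}} f-c≤0 ⟩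
  0ℤ           ∎
  where
  open ℤ.≤-Reasoning

  f : Vector ℤ m
  f a = + w a ℤ.* (0ℤ ℤ.⊔ u a)

  f≥0 : ∀ a → 0ℤ ℤ.≤ f a
  f≥0 a = begin
    0ℤ          ≡⟨ ℤ.*-zeroʳ (+ w a) ⟨
    + w a ℤ.* 0ℤ  ≤⟨ ℤ.*-monoˡ-≤-nonNeg (+ w a) (ℤ.i≤i⊔j 0ℤ (u a)) ⟩
    f a         ∎

  1≤f-b : 1ℤ ℤ.≤ f b
  1≤f-b = begin
    1ℤ                      ≤⟨ ℤ.+≤+ (w>0 b) ⟩
    + w b                   ≡⟨ ℤ.*-identityʳ (+ w b) ⟨
    + w b ℤ.* (0ℤ ℤ.⊔ 1ℤ)   ≡⟨ cong (λ z → + w b ℤ.* (0ℤ ℤ.⊔ z)) ub≡1 ⟨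
    f b                     ∎

  f-c≤0 : f c ℤ.≤ + w c ℤ.* 0ℤ
  f-c≤0 = begin
    f c                       ≡⟨ cancel (f c) ⟩
    -1ℤ ℤ.+ (1ℤ ℤ.+ f c)      ≤⟨ ℤ.+-monoʳ-≤ -1ℤ (ℤ.+-monoˡ-≤ (f c) 1≤f-b) ⟩
    -1ℤ ℤ.+ (f b ℤ.+ f c)     ≤⟨ ℤ.+-monoʳ-≤ -1ℤ (two-terms≤sum f f≥0 (c≢b ∘ sym)) ⟩
    -1ℤ ℤ.+ ℤΣ.sum f          ≡⟨ cong (λ z → -1ℤ ℤ.+ z) ∑≡1 ⟩
    0ℤ                        ≡⟨ ℤ.*-zeroʳ (+ w c) ⟨
    + w c ℤ.* 0ℤ              ∎
    where
    cancel : ∀ z → z ≡ -1ℤ ℤ.+ (1ℤ ℤ.+ z)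
    cancel z = trans (sym (ℤ.+-identityˡ z)) (ℤ.+-assoc -1ℤ 1ℤ z)

0⊔-split : ∀ z → 0ℤ ℤ.⊔ z ≡ (0ℤ ℤ.⊔ (ℤ.- z)) ℤ.+ z
0⊔-split (+ 0)       = refl
0⊔-split (+ (suc n)) = refl
0⊔-split (-[1+ n ])  = sym (ℤ.+-inverseʳ (+ (suc n)))

module _ {n : ℕ} (F : Fan n) where
  open Fan F

  balanced-pairing : ∀ (l : Dual n) → ∑[ a < size ] (+ weight a ℤ.* l ⟨ gen a ⟩) ≡ 0ℤ
  balanced-pairing l = begin
    ∑[ a < size ] (+ weight a ℤ.* l ⟨ gen a ⟩)
      ≡⟨ pairing-∑ l (λ a → + weight a) gen ⟨
    ∑[ x < n ] (l x ℤ.* ∑[ a < size ] (+ weight a ℤ.* gen a x))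
      ≡⟨ ℤΣ.sum-cong-≗ (λ x → trans (cong (l x ℤ.*_) (balanced x)) (ℤ.*-zeroʳ (l x))) ⟩
    ∑[ x < n ] 0ℤ
      ≡⟨ ℤΣ.sum-replicate-zero n ⟩
    0ℤ ∎
    where open ≡-Reasoning

  degree-negative-part : ∀ (l : Dual n) →
    ∑[ a < size ] (+ weight a ℤ.* (0ℤ ℤ.⊔ (ℤ.- l ⟨ gen a ⟩))) ≡ degree F l
  degree-negative-part l = sym (begin
    ∑[ a < size ] (+ weight a ℤ.* (0ℤ ℤ.⊔ l ⟨ gen a ⟩))
      ≡⟨ ℤΣ.sum-cong-≗ (λ a → trans (cong (+ weight a ℤ.*_) (0⊔-split (l ⟨ gen a ⟩)))
           (ℤ.*-distribˡ-+ (+ weight a) (0ℤ ℤ.⊔ (ℤ.- l ⟨ gen a ⟩)) (l ⟨ gen a ⟩))) ⟩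
    ∑[ a < size ] (g a ℤ.+ + weight a ℤ.* l ⟨ gen a ⟩)
      ≡⟨ ℤΣ.∑-distrib-+ g (λ a → + weight a ℤ.* l ⟨ gen a ⟩) ⟩
    ℤΣ.sum g ℤ.+ ∑[ a < size ] (+ weight a ℤ.* l ⟨ gen a ⟩)
      ≡⟨ cong (λ z → ℤΣ.sum g ℤ.+ z) (balanced-pairing l) ⟩
    ℤΣ.sum g ℤ.+ 0ℤ
      ≡⟨ ℤ.+-identityʳ (ℤΣ.sum g) ⟩
    ℤΣ.sum g ∎)
    where
    open ≡-Reasoning
    g : Vector ℤ size
    g a = + weight a ℤ.* (0ℤ ℤ.⊔ (ℤ.- l ⟨ gen a ⟩))

  gallery-vanishes : ∀ {l a b} → IsGallery F l a b →
                     ∀ {c} → c ≢ a → c ≢ b → l ⟨ gen c ⟩ ≡ 0ℤ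
  gallery-vanishes {l} (deg≡1 , _ , la≡1 , lb≡-1) c≢a c≢b = ℤ.≤-antisym
    (positive-part-concentrated weight positive (λ a → l ⟨ gen a ⟩) deg≡1 la≡1 c≢a)
    (ℤ.neg-cancel-≤ (positive-part-concentrated weight positive (λ a → ℤ.- l ⟨ gen a ⟩)
      (trans (degree-negative-part l) deg≡1) (cong ℤ.-_ lb≡-1) c≢b))

ι : ℤ → ℚ
ι z = z ℚ./ 1

ι-homo-+ : ∀ y z → ι (y ℤ.+ z) ≡ ι y ℚ.+ ι z
ι-homo-+ y z = ℚ.toℚᵘ-injective (begin
  toℚᵘ (ι (y ℤ.+ z))               ≈⟨ ℚ.toℚᵘ-fromℚᵘ _ ⟩
  ℚᵘ.mkℚᵘ (y ℤ.+ z) 0              ≈⟨ ℚᵘ.*≡* (cong (ℤ._* 1ℤ)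
                                       (cong₂ ℤ._+_ (sym (ℤ.*-identityʳ y)) (sym (ℤ.*-identityʳ z)))) ⟩
  ℚᵘ.mkℚᵘ y 0 ℚᵘ.+ ℚᵘ.mkℚᵘ z 0     ≈⟨ ℚᵘ.+-cong (ℚ.toℚᵘ-fromℚᵘ (ℚᵘ.mkℚᵘ y 0)) (ℚ.toℚᵘ-fromℚᵘ (ℚᵘ.mkℚᵘ z 0)) ⟨
  toℚᵘ (ι y) ℚᵘ.+ toℚᵘ (ι z)       ≈⟨ ℚ.toℚᵘ-homo-+ (ι y) (ι z) ⟨
  toℚᵘ (ι y ℚ.+ ι z)               ∎)
  where open ℚᵘ.≃-Reasoning

ι-homo-* : ∀ y z → ι (y ℤ.* z) ≡ ι y ℚ.* ι z
ι-homo-* y z = ℚ.toℚᵘ-injective (begin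
  toℚᵘ (ι (y ℤ.* z))               ≈⟨ ℚ.toℚᵘ-fromℚᵘ _ ⟩
  ℚᵘ.mkℚᵘ y 0 ℚᵘ.* ℚᵘ.mkℚᵘ z 0     ≈⟨ ℚᵘ.*-cong (ℚ.toℚᵘ-fromℚᵘ (ℚᵘ.mkℚᵘ y 0)) (ℚ.toℚᵘ-fromℚᵘ (ℚᵘ.mkℚᵘ z 0)) ⟨
  toℚᵘ (ι y) ℚᵘ.* toℚᵘ (ι z)       ≈⟨ ℚ.toℚᵘ-homo-* (ι y) (ι z) ⟨
  toℚᵘ (ι y ℚ.* ι z)               ∎)
  where open ℚᵘ.≃-Reasoning

ι-homo-∑ : ∀ {n} (z : Vector ℤ n) → ι (ℤΣ.sum z) ≡ ℚΣ.sum (ι ∘ z)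
ι-homo-∑ {ℕ.zero} z = refl
ι-homo-∑ {suc n}  z = trans (ι-homo-+ (z zero) _) (cong (ι (z zero) ℚ.+_) (ι-homo-∑ (z ∘ suc)))

Null : (ℕ → ℚ) → Set
Null s = ∀ ε → 0ℚ ℚ.< ε → ∃ λ N → ∀ t → N ≤ t → ℚ.∣ s t ∣ ℚ.< ε

Null-resp : ∀ {s r} → (∀ t → s t ≡ r t) → Null s → Null r
Null-resp s≗r s→0 ε 0<ε with s→0 ε 0<ε
... | N , p = N , λ t N≤t → subst (λ q → ℚ.∣ q ∣ ℚ.< ε) (s≗r t) (p t N≤t)

≃0⇒Null : ∀ {x} → x ≃ 0ℝ → Null (seq x)
≃0⇒Null {x} = Null-resp (λ t → ℚ.+-identityʳ (seq x t))

Null⇒≃0 : ∀ {x} → Null (seq x) → x ≃ 0ℝ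
Null⇒≃0 {x} = Null-resp (λ t → sym (ℚ.+-identityʳ (seq x t)))

Null-+ : ∀ {s r} → Null s → Null r → Null (λ t → s t ℚ.+ r t)
Null-+ {s} {r} s→0 r→0 ε 0<ε with s→0 (½ ℚ.* ε) 0<ε/2 | r→0 (½ ℚ.* ε) 0<ε/2
  where
  0<ε/2 : 0ℚ ℚ.< ½ ℚ.* ε
  0<ε/2 = ℚ.*-monoʳ-<-pos ½ 0<ε
... | N₁ , p₁ | N₂ , p₂ = N₁ ℕ.⊔ N₂ , λ t N≤t → begin-strict
  ℚ.∣ s t ℚ.+ r t ∣          ≤⟨ ℚ.∣p+q∣≤∣p∣+∣q∣ (s t) (r t) ⟩
  ℚ.∣ s t ∣ ℚ.+ ℚ.∣ r t ∣    <⟨ ℚ.+-mono-< (p₁ t (ℕ.m⊔n≤o⇒m≤o N₁ N₂ N≤t))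
                                          (p₂ t (ℕ.m⊔n≤o⇒n≤o N₁ N₂ N≤t)) ⟩
  ½ ℚ.* ε ℚ.+ ½ ℚ.* ε        ≡⟨ ℚ.*-distribʳ-+ ε ½ ½ ⟨
  1ℚ ℚ.* ε                   ≡⟨ ℚ.*-identityˡ ε ⟩
  ε                          ∎
  where open ℚ.≤-Reasoning

Null-* : ∀ q {s} → Null s → Null (λ t → q ℚ.* s t)
Null-* q {s} s→0 ε 0<ε = N , λ t N≤t → begin-strict
  ℚ.∣ q ℚ.* s t ∣         ≡⟨ ℚ.∣p*q∣≡∣p∣*∣q∣ q (s t) ⟩
  ℚ.∣ q ∣ ℚ.* ℚ.∣ s t ∣   ≤⟨ ℚ.*-monoʳ-≤-nonNeg ℚ.∣ s t ∣ {{ℚ.∣-∣-nonNeg (s t)}} ∣q∣≤B ⟩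
  B ℚ.* ℚ.∣ s t ∣         <⟨ ℚ.*-monoʳ-<-pos B (∣s∣<B⁻¹ε t N≤t) ⟩
  B ℚ.* (B⁻¹ ℚ.* ε)       ≡⟨ ℚ.*-assoc B B⁻¹ ε ⟨
  (B ℚ.* B⁻¹) ℚ.* ε       ≡⟨ cong (ℚ._* ε) (ℚ.*-inverseʳ B) ⟩
  1ℚ ℚ.* ε                ≡⟨ ℚ.*-identityˡ ε ⟩
  ε                       ∎
  where
  open ℚ.≤-Reasoning

  B : ℚ
  B = 1ℚ ℚ.+ ℚ.∣ q ∣

  instance
    B-pos : ℚ.Positive B
    B-pos = ℚ.pos+nonNeg⇒pos 1ℚ ℚ.∣ q ∣ {{ℚ.∣-∣-nonNeg q}}

    B-nonZero : ℚ.NonZero B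
    B-nonZero = ℚ.pos⇒nonZero B {{B-pos}}

  B⁻¹ : ℚ
  B⁻¹ = ℚ.1/ B

  0<B⁻¹ε : 0ℚ ℚ.< B⁻¹ ℚ.* ε
  0<B⁻¹ε = subst (ℚ._< B⁻¹ ℚ.* ε) (ℚ.*-zeroʳ B⁻¹)
             (ℚ.*-monoʳ-<-pos B⁻¹ {{ℚ.1/pos⇒pos B}} 0<ε)

  ∣q∣≤B : ℚ.∣ q ∣ ℚ.≤ B
  ∣q∣≤B = subst (ℚ._≤ B) (ℚ.+-identityˡ ℚ.∣ q ∣)
            (ℚ.+-monoˡ-≤ ℚ.∣ q ∣ (ℚ.<⇒≤ (ℚ.positive⁻¹ 1ℚ)))

  N : ℕ
  N = proj₁ (s→0 (B⁻¹ ℚ.* ε) 0<B⁻¹ε)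

  ∣s∣<B⁻¹ε : ∀ t → N ≤ t → ℚ.∣ s t ∣ ℚ.< B⁻¹ ℚ.* ε
  ∣s∣<B⁻¹ε = proj₂ (s→0 (B⁻¹ ℚ.* ε) 0<B⁻¹ε)

Null-∑ : ∀ {m} (s : Fin m → ℕ → ℚ) → (∀ a → Null (s a)) → Null (λ t → ℚΣ.sum (λ a → s a t))
Null-∑ {ℕ.zero} s s→0 ε 0<ε = 0 , λ _ _ → 0<ε
Null-∑ {suc m}  s s→0       = Null-+ (s→0 zero) (Null-∑ (s ∘ suc) (s→0 ∘ suc))

seq-sumᴿ : ∀ {m} (x : Vector ℝ m) t → seq (sumᴿ x) t ≡ ℚΣ.sum (λ a → seq (x a) t)
seq-sumᴿ {ℕ.zero} x t = refl
seq-sumᴿ {suc m}  x t = cong (seq (x zero) t ℚ.+_) (seq-sumᴿ (x ∘ suc) t)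

pairing-linComb :
  ∀ {m n} (c : Vector ℝ m) (w : Vector (Dual n) m) (v : Vector ℤ n) t →
  ℚΣ.sum (λ x → ι (v x) ℚ.* seq (linComb c w x) t) ≡
  ℚΣ.sum (λ a → ι (w a ⟨ v ⟩) ℚ.* seq (c a) t)
pairing-linComb c w v t = begin
  ℚΣ.sum (λ x → ι (v x) ℚ.* seq (linComb c w x) t)
    ≡⟨ ℚΣ.sum-cong-≗ (λ x → trans (cong (ι (v x) ℚ.*_) (seq-sumᴿ (λ a → w a x ·ᴿ c a) t))
                                  (ℚΣ.*-distribˡ-sum (ι (v x)) (λ a → ι (w a x) ℚ.* seq (c a) t))) ⟩
  ℚΣ.sum (λ x → ℚΣ.sum (λ a → ι (v x) ℚ.* (ι (w a x) ℚ.* seq (c a) t)))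
    ≡⟨ ℚΣ.∑-comm (λ x a → ι (v x) ℚ.* (ι (w a x) ℚ.* seq (c a) t)) ⟩
  ℚΣ.sum (λ a → ℚΣ.sum (λ x → ι (v x) ℚ.* (ι (w a x) ℚ.* seq (c a) t)))
    ≡⟨ ℚΣ.sum-cong-≗ (λ a → ℚΣ.sum-cong-≗ (λ x →
         trans (rotate (ι (v x)) (ι (w a x)) (seq (c a) t))
               (cong (ℚ._* seq (c a) t) (sym (ι-homo-* (w a x) (v x)))))) ⟩
  ℚΣ.sum (λ a → ℚΣ.sum (λ x → ι (w a x ℤ.* v x) ℚ.* seq (c a) t))
    ≡⟨ ℚΣ.sum-cong-≗ (λ a →
         trans (cong (ℚ._* seq (c a) t) (ι-homo-∑ (λ x → w a x ℤ.* v x)))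
               (ℚΣ.*-distribʳ-sum (seq (c a) t) (λ x → ι (w a x ℤ.* v x)))) ⟨
  ℚΣ.sum (λ a → ι (w a ⟨ v ⟩) ℚ.* seq (c a) t) ∎
  where
  open ≡-Reasoning
  rotate : ∀ p q r → p ℚ.* (q ℚ.* r) ≡ (q ℚ.* p) ℚ.* r
  rotate = solve 3 (λ p q r → p :* (q :* r) := (q :* p) :* r) refl
    where open ℚ.+-*-Solver

module _ {k n : ℕ} (M : Vector (Dual n) k) (V : Vector (Vector ℤ n) k)
         (diagonal     : ∀ j → M j ⟨ V j ⟩ ≡ -1ℤ)
         (off-diagonal : ∀ j m → j ≢ m → M j ⟨ V m ⟩ ≡ 0ℤ) where

  dual⇒linearlyIndependent : LinearlyIndependent M
  dual⇒linearlyIndependent c ∑≃0 m = Null⇒≃0 {c m} (Null-resp recover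
    (Null-* (ι -1ℤ) (Null-∑ (λ x t → ι (V m x) ℚ.* seq (linComb c M x) t)
      (λ x → Null-* (ι (V m x)) (≃0⇒Null {linComb c M x} (∑≃0 x))))))
    where
    open ≡-Reasoning
    recover : ∀ t → ι -1ℤ ℚ.* ℚΣ.sum (λ x → ι (V m x) ℚ.* seq (linComb c M x) t) ≡ seq (c m) t
    recover t = begin
      ι -1ℤ ℚ.* ℚΣ.sum (λ x → ι (V m x) ℚ.* seq (linComb c M x) t)
        ≡⟨ cong (ι -1ℤ ℚ.*_) (pairing-linComb c M (V m) t) ⟩
      ι -1ℤ ℚ.* ℚΣ.sum (λ j → ι (M j ⟨ V m ⟩) ℚ.* seq (c j) t)
        ≡⟨ cong (ι -1ℤ ℚ.*_) (sum-single ℚ.+-0-commutativeMonoid _ m (λ j j≢m →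
             trans (cong (λ z → ι z ℚ.* seq (c j) t) (off-diagonal j m j≢m))
                   (ℚ.*-zeroˡ (seq (c j) t)))) ⟩
      ι -1ℤ ℚ.* (ι (M m ⟨ V m ⟩) ℚ.* seq (c m) t)
        ≡⟨ cong (λ z → ι -1ℤ ℚ.* (ι z ℚ.* seq (c m) t)) (diagonal m) ⟩
      ι -1ℤ ℚ.* (ι -1ℤ ℚ.* seq (c m) t)
        ≡⟨ ℚ.*-assoc (ι -1ℤ) (ι -1ℤ) (seq (c m) t) ⟨
      1ℚ ℚ.* seq (c m) t
        ≡⟨ ℚ.*-identityˡ (seq (c m) t) ⟩
      seq (c m) t ∎

  dual⇒surjective : ∀ (y : Vector ℤ k) → ∃ λ v → ∀ j → y j ≡ matrixMap M v j
  dual⇒surjective y = (λ x → ∑[ m < k ] (ℤ.- y m ℤ.* V m x)) , λ j → sym (begin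
    M j ⟨ (λ x → ∑[ m < k ] (ℤ.- y m ℤ.* V m x)) ⟩
      ≡⟨ pairing-∑ (M j) (λ m → ℤ.- y m) V ⟩
    ∑[ m < k ] (ℤ.- y m ℤ.* M j ⟨ V m ⟩)
      ≡⟨ sum-single ℤ.+-0-commutativeMonoid _ j (λ m m≢j →
           trans (cong (ℤ.- y m ℤ.*_) (off-diagonal j m (m≢j ∘ sym))) (ℤ.*-zeroʳ (ℤ.- y m))) ⟩
    ℤ.- y j ℤ.* M j ⟨ V j ⟩
      ≡⟨ cong (ℤ.- y j ℤ.*_) (diagonal j) ⟩
    ℤ.- y j ℤ.* -1ℤ
      ≡⟨ solve 1 (λ a → :- a :* con -1ℤ := a) refl (y j) ⟩
    y j ∎)
    where
    open ≡-Reasoning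
    open ℤ.+-*-Solver

surjective⇒trivialCokernel : ∀ {k n} (M : Vector (Dual n) k) →
  (∀ (y : Vector ℤ k) → ∃ λ v → ∀ j → y j ≡ matrixMap M v j) → HasCardinality (Cokernel M) 1
surjective⇒trivialCokernel M onto = record
  { to        = λ _ → zero
  ; cong      = λ _ → refl
  ; bijective = (λ {y} {z} _ → onto (λ j → y j ℤ.- z j))
              , λ { zero → (λ _ → 0ℤ) , λ _ → refl }
  }

corollary3p12 : (n : ℕ) (F : Fan n) → RaysSpan F →
    (k : ℕ) → 2 ≤ suc k →
    (p : Fin (suc k) → Fan.Ray F) → Injective _≡_ _≡_ p →
    IsGalleryClass F (image p) →
    (i : Fin (suc k)) →
    (l : Fin k → Dual n) →
    (∀ (j : Fin k) → IsGallery F (l j) (p i) (p (punchIn i j))) →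
    LinearlyIndependent l × HasCardinality (Cokernel l) 1
corollary3p12 n F _ k _ p p-injective _ i l gallery =
  dual⇒linearlyIndependent l V diagonal off-diagonal ,
  surjective⇒trivialCokernel l (dual⇒surjective l V diagonal off-diagonal)
  where
  V : Vector (Vector ℤ n) k
  V j = Fan.gen F (p (punchIn i j))

  diagonal : ∀ j → l j ⟨ V j ⟩ ≡ -1ℤ
  diagonal j with gallery j
  ... | _ , _ , _ , lⱼ≡-1 = lⱼ≡-1

  off-diagonal : ∀ j m → j ≢ m → l j ⟨ V m ⟩ ≡ 0ℤ
  off-diagonal j m j≢m = gallery-vanishes F {l j} (gallery j)
    (punchInᵢ≢i i m ∘ p-injective)
    (j≢m ∘ sym ∘ punchIn-injective i m j ∘ p-injective)
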